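{- Let $n\geqslant 2$ and let $C_n$ be a caterpillar graph with $n$ spine vertices and a total of $L(C_n)$ leaves. If there is a non-zero modified balanced domination function (MBDF) $f$ on $C_n$, then $L(C_n)\equiv 3n-2 \pmod 4$.
   Context: For a simple undirected finite graph $G$ and $v\in V(G)$, the closed neighborhood is $N_G[v]=\{u\in V(G): uv\in E(G)\}\cup\{v\}$. A function $f\colon V(G)\to\{ -1,0,1\}$ is a balanced domination function (BDF) on $G$ if $\sum_{u\in N_G[v]} f(u)=0$ for every $v\in V(G)$. A caterpillar graph $C_n$ with $n$ spine vertices consists of a path $a_1,a_2,\dotsc,a_n$ (the spine, with edges $a_ia_{i+1}$ for $1\leqslant i\leqslant n-1$), where each spine vertex $a_i$ has $l_i\geqslant 0$ leaves attached, denoted $a_{i,1},\dotsc,a_{i,l_i}$ if $l_i\geqslant 1$, each adjacent only to $a_i$. (Here $n$ is the number of spine vertices, and the leaves counted are the attached vertices $a_{i,j}$.) The total number of leaves is $L(C_n)=\sum_{i=1}^n l_i$. A function $f\colon V(C_n)\to\{ -1,0,1\}$ is a modified balanced domination function (MBDF) on $C_n$ if $f$ is a BDF on $C_n$ such that $f(a_i)\in\{ -1,1\}$ for every spine vertex $a_i$ with $l_i\neq 1$. Non-zero means not identically zero. -}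

module Defs where

open import Data.Nat as ℕ using (ℕ; suc)
open import Data.Nat.Properties using (m≢1+m+n; +-identityʳ)
open import Data.Nat.ListAction using (sum)
open import Data.Integer as ℤ using (ℤ; 0ℤ; 1ℤ; -1ℤ)
import Data.Integer.Divisibility as ℤ
open import Data.Fin as Fin using (Fin; toℕ)
open import Data.List using (List; _++_; allFin; concatMap; filter; foldr; map; tabulate)
open import Data.List.Membership.Propositional using (_∈_)
open import Data.List.Membership.Propositional.Properties
  using (∈-map⁺; ∈-map⁻; ∈-++⁺ˡ; ∈-++⁺ʳ; ∈-concatMap⁺; ∈-concatMap⁻; ∈-allFin)
open import Data.List.Relation.Binary.Disjoint.Propositional using (Disjoint)
open import Data.List.Relation.Unary.All using (universal)
import Data.List.Relation.Unary.All.Properties as All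
import Data.List.Relation.Unary.AllPairs as AllPairs
import Data.List.Relation.Unary.AllPairs.Properties as AllPairs
import Data.List.Relation.Unary.Any as Any
open import Data.List.Relation.Unary.Unique.Propositional using (Unique)
import Data.List.Relation.Unary.Unique.Propositional.Properties as Unique
open import Data.Product using (_×_; _,_)
open import Data.Sum using (_⊎_; inj₁; inj₂)
open import Level using (0ℓ)
open import Relation.Binary.Core using (Rel)
open import Relation.Binary.Definitions using (Decidable; DecidableEquality; Irreflexive; Symmetric)
open import Relation.Binary.PropositionalEquality using (_≡_; _≢_; refl; sym; trans; cong)
open import Relation.Nullary using (¬_; yes; no)
open import Relation.Nullary.Decidable using (map′; _⊎-dec_)

record FiniteSimpleGraph : Set₁ where
  infix 4 _~_ _~?_ _≟_
  field
    V        : Set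
    _≟_      : DecidableEquality V
    vertices : List V
    complete : ∀ v → v ∈ vertices
    unique   : Unique vertices
    _~_      : Rel V 0ℓ
    _~?_     : Decidable _~_
    ~-sym    : Symmetric _~_
    ~-irrefl : Irreflexive _≡_ _~_

  N[_] : V → List V
  N[ v ] = filter (λ u → (u ~? v) ⊎-dec (u ≟ v)) vertices

-- The codomain {-1, 0, 1}.
data Value : Set where
  -1# 0# 1# : Value

toℤ : Value → ℤ
toℤ -1# = -1ℤ
toℤ 0#  = 0ℤ
toℤ 1#  = 1ℤ

sumℤ : List ℤ → ℤ
sumℤ = foldr ℤ._+_ 0ℤ

IsBDF : (G : FiniteSimpleGraph) → (FiniteSimpleGraph.V G → Value) → Set
IsBDF G f = ∀ v → sumℤ (map (λ u → toℤ (f u)) N[ v ]) ≡ 0ℤ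
  where open FiniteSimpleGraph G

NonZeroFunction : {A : Set} → (A → Value) → Set
NonZeroFunction f = ¬ (∀ v → f v ≡ 0#)

-- Indices are shifted by one: `spine i` is a_{i+1} and `leaf i j` is a_{i+1,j+1}.
data Vertex {n : ℕ} (l : Fin n → ℕ) : Set where
  spine : Fin n → Vertex l
  leaf  : (i : Fin n) → Fin (l i) → Vertex l

data Adjacent {n : ℕ} {l : Fin n → ℕ} : Rel (Vertex l) 0ℓ where
  next   : ∀ {i j} → toℕ j ≡ suc (toℕ i) → Adjacent (spine i) (spine j)
  prev   : ∀ {i j} → toℕ i ≡ suc (toℕ j) → Adjacent (spine i) (spine j)
  toLeaf : ∀ {i j} → Adjacent (spine i) (leaf i j)
  toStem : ∀ {i j} → Adjacent (leaf i j) (spine i)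

module _ {n : ℕ} {l : Fin n → ℕ} where

  spine-injective : ∀ {i j} → spine {l = l} i ≡ spine j → i ≡ j
  spine-injective refl = refl

  leaf-injective : ∀ {i} {j k : Fin (l i)} → leaf {l = l} i j ≡ leaf i k → j ≡ k
  leaf-injective refl = refl

  infix 4 _≟ᵛ_
  _≟ᵛ_ : DecidableEquality (Vertex l)
  spine i  ≟ᵛ spine j  = map′ (cong spine) spine-injective (i Fin.≟ j)
  spine _  ≟ᵛ leaf _ _ = no λ ()
  leaf _ _ ≟ᵛ spine _  = no λ ()
  leaf i j ≟ᵛ leaf i′ j′ with i Fin.≟ i′
  ... | yes refl = map′ (cong (leaf i)) leaf-injective (j Fin.≟ j′)
  ... | no i≢i′  = no λ { refl → i≢i′ refl }

  adjacent? : Decidable (Adjacent {l = l})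
  adjacent? (spine i) (spine j) = map′
    (λ { (inj₁ e) → next e ; (inj₂ e) → prev e })
    (λ { (next e) → inj₁ e ; (prev e) → inj₂ e })
    ((toℕ j ℕ.≟ suc (toℕ i)) ⊎-dec (toℕ i ℕ.≟ suc (toℕ j)))
  adjacent? (spine i) (leaf i′ _) =
    map′ (λ { refl → toLeaf }) (λ { toLeaf → refl }) (i Fin.≟ i′)
  adjacent? (leaf i _) (spine i′) =
    map′ (λ { refl → toStem }) (λ { toStem → refl }) (i Fin.≟ i′)
  adjacent? (leaf _ _) (leaf _ _) = no λ ()

  adjacent-sym : Symmetric (Adjacent {l = l})
  adjacent-sym (next e) = prev e
  adjacent-sym (prev e) = next e
  adjacent-sym toLeaf   = toStem
  adjacent-sym toStem   = toLeaf

  adjacent-irrefl : Irreflexive _≡_ (Adjacent {l = l})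
  adjacent-irrefl refl (next e) = m≢1+m+n _ (trans e (cong suc (sym (+-identityʳ _))))
  adjacent-irrefl refl (prev e) = m≢1+m+n _ (trans e (cong suc (sym (+-identityʳ _))))

module _ {n : ℕ} (l : Fin n → ℕ) where

  spines : List (Vertex l)
  spines = map spine (allFin n)

  leavesAt : Fin n → List (Vertex l)
  leavesAt i = map (leaf i) (allFin (l i))

  leaves : List (Vertex l)
  leaves = concatMap leavesAt (allFin n)

  allVertices : List (Vertex l)
  allVertices = spines ++ leaves

  allVertices-complete : ∀ v → v ∈ allVertices
  allVertices-complete (spine i)  = ∈-++⁺ˡ (∈-map⁺ spine (∈-allFin i))
  allVertices-complete (leaf i j) = ∈-++⁺ʳ spines
    (∈-concatMap⁺ leavesAt
      (Any.map (λ { refl → ∈-map⁺ (leaf i) (∈-allFin j) }) (∈-allFin i)))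

  leavesAt-disjoint : ∀ {i j} → i ≢ j → Disjoint (leavesAt i) (leavesAt j)
  leavesAt-disjoint {i} {j} i≢j (p , q)
    with ∈-map⁻ (leaf i) p | ∈-map⁻ (leaf j) q
  ... | _ , _ , refl | _ , _ , refl = i≢j refl

  spines-leaves-disjoint : Disjoint spines leaves
  spines-leaves-disjoint (p , q)
    with ∈-map⁻ spine p | Any.satisfied (∈-concatMap⁻ leavesAt {xs = allFin n} q)
  ... | _ , _ , refl | i , r with ∈-map⁻ (leaf i) r
  ...   | _ , _ , ()

  leaves-unique : Unique leaves
  leaves-unique = Unique.concat⁺
    (All.map⁺ (universal (λ i → Unique.map⁺ leaf-injective (Unique.allFin⁺ (l i))) (allFin n)))
    (AllPairs.map⁺ (AllPairs.map leavesAt-disjoint (Unique.allFin⁺ n)))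

  allVertices-unique : Unique allVertices
  allVertices-unique = Unique.++⁺
    (Unique.map⁺ spine-injective (Unique.allFin⁺ n)) leaves-unique spines-leaves-disjoint

  caterpillar : FiniteSimpleGraph
  caterpillar = record
    { V        = Vertex l
    ; _≟_      = _≟ᵛ_
    ; vertices = allVertices
    ; complete = allVertices-complete
    ; unique   = allVertices-unique
    ; _~_      = Adjacent
    ; _~?_     = adjacent?
    ; ~-sym    = adjacent-sym
    ; ~-irrefl = adjacent-irrefl
    }

  totalLeaves : ℕ
  totalLeaves = sum (tabulate l)

  IsMBDF : (Vertex l → Value) → Set
  IsMBDF f = IsBDF caterpillar f ×
             (∀ i → l i ≢ 1 → f (spine i) ≡ -1# ⊎ f (spine i) ≡ 1#)

infix 4 _≡_[mod_]
_≡_[mod_] : ℤ → ℤ → ℤ → Set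
a ≡ b [mod m ] = m ℤ.∣ a ℤ.- b

{-# OPTIONS --safe #-}
-- Write xᵢ = f(aᵢ), with x₀ = xₙ₊₁ = 0. Every leaf at aᵢ has the value −xᵢ, so
-- the condition at aᵢ reads (lᵢ − 1)xᵢ = xᵢ₋₁ + xᵢ₊₁. As xᵢ = ±1 unless lᵢ = 1,
-- this gives lᵢ = 1 + xᵢ(xᵢ₋₁ + xᵢ₊₁) in all cases. The recurrence allows no two
-- consecutive zeros unless x = 0, hence 2xᵢ² + 2xᵢxᵢ₊₁ − 2xᵢ₊₁² − 2 is always
-- divisible by 4. By induction from the end of the spine, the last m spine vertices,
-- beginning with aᵢ, carry 3m + xᵢ₋₁xᵢ − 2xᵢ² leaves modulo 4; take i = 1.
module Submission where

open import Defs
open import Data.Nat using (ℕ; _≥_)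
open import Data.Integer using (+_; _*_; _-_)
open import Data.Fin using (Fin)
open import Data.Product using (∃; _×_)

import Data.Nat as ℕ
import Data.Nat.Properties as ℕ
open import Data.Integer using (ℤ; 0ℤ; 1ℤ; -1ℤ; _+_; -_)
open import Data.Integer.Divisibility.Signed using (divides; ∣⇒∣ᵤ)
open import Data.Integer.Properties
  using (+-0-commutativeMonoid; +-identityˡ; +-identityʳ; +-assoc)
open import Data.Integer.Tactic.RingSolver using (solve-∀)
open import Data.Fin using (zero; suc; toℕ; inject₁)
open import Data.Fin.Properties using (toℕ-injective; toℕ-inject₁)
open import Data.List using (List; []; _∷_; [_]; _++_; map; allFin; length)
open import Data.List.Properties using (map-∘; map-++; map-cong; length-tabulate)
open import Data.List.Membership.Propositional using (_∈_)
open import Data.List.Membership.Propositional.Properties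
  using (∈-map⁺; ∈-map⁻; ∈-++⁺ˡ; ∈-++⁺ʳ; ∈-++⁻; ∈-allFin; ∈-filter⁺; ∈-filter⁻)
open import Data.List.Membership.Propositional.Properties.WithK using (unique∧set⇒bag)
open import Data.List.Relation.Binary.BagAndSetEquality using (∼bag⇒↭)
open import Data.List.Relation.Binary.Permutation.Propositional using (_↭_; ↭⇒↭ₛ)
open import Data.List.Relation.Binary.Permutation.Propositional.Properties using (map⁺)
open import Data.List.Relation.Binary.Permutation.Setoid.Properties using (foldr-commMonoid)
open import Data.List.Relation.Unary.All using ([]; _∷_)
import Data.List.Relation.Unary.All as All
open import Data.List.Relation.Unary.AllPairs using ([]; _∷_)
open import Data.List.Relation.Unary.Any using (here; there)
open import Data.List.Relation.Unary.Unique.Propositional using (Unique)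
import Data.List.Relation.Unary.Unique.Propositional.Properties as Unique
open import Algebra.Bundles using (CommutativeMonoid)
open import Data.Product using (_,_; proj₁; proj₂)
open import Data.Sum using (_⊎_; inj₁; inj₂)
open import Function using (_∘_; const)
open import Function.Bundles using (mk⇔)
open import Relation.Binary.PropositionalEquality
  using (_≡_; _≢_; refl; sym; trans; cong; cong₂; subst; module ≡-Reasoning)
open import Relation.Nullary using (¬_; yes; no; contradiction)

open ≡-Reasoning

-- Finite sums of integers.

sumℤ-++ : ∀ xs ys → sumℤ (xs ++ ys) ≡ sumℤ xs + sumℤ ys
sumℤ-++ []       ys = sym (+-identityˡ _)
sumℤ-++ (x ∷ xs) ys = trans (cong (_+_ x) (sumℤ-++ xs ys)) (sym (+-assoc x _ _))

sumℤ-↭ : ∀ {xs ys} → xs ↭ ys → sumℤ xs ≡ sumℤ ys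
sumℤ-↭ p = foldr-commMonoid M.setoid M.isCommutativeMonoid (↭⇒↭ₛ p)
  where module M = CommutativeMonoid +-0-commutativeMonoid

sumℤ-const : ∀ {A : Set} (c : ℤ) (xs : List A) →
  sumℤ (map (const c) xs) ≡ + length xs * c
sumℤ-const c []       = refl
sumℤ-const c (x ∷ xs) = trans (cong (_+_ c) (sumℤ-const c xs)) (lemma (+ length xs) c)
  where
  lemma : ∀ k c → c + k * c ≡ (1ℤ + k) * c
  lemma = solve-∀

toℤ-zero : ∀ {x} → toℤ x ≡ 0ℤ → x ≡ 0#
toℤ-zero {0#} _ = refl

-- Sums over a closed neighbourhood.

module _ (G : FiniteSimpleGraph) where
  open FiniteSimpleGraph G

  -- Two duplicate-free lists with the same members are permutations of each other, and a
  -- commutative sum ignores order. This lets an explicit enumeration replace the filtered list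
  -- `N[ v ]`.
  sumℤ-neighbourhood : ∀ (g : V → ℤ) v ys → Unique ys →
    (∀ {u} → u ∈ ys → u ~ v ⊎ u ≡ v) → (∀ {u} → u ~ v ⊎ u ≡ v → u ∈ ys) →
    sumℤ (map g N[ v ]) ≡ sumℤ (map g ys)
  sumℤ-neighbourhood g v ys ys! sound complete′ = sumℤ-↭ (map⁺ g (∼bag⇒↭
    (unique∧set⇒bag (Unique.filter⁺ _ unique) ys!
      (mk⇔ (λ u∈N → complete′ (proj₂ (∈-filter⁻ _ {xs = vertices} u∈N)))
           (λ u∈ys → ∈-filter⁺ _ (complete _) (sound u∈ys))))))

-- Neighbours within the spine.

before after : ∀ {n} → Fin n → List (Fin n)
before zero    = []
before (suc i) = [ inject₁ i ]
after {ℕ.suc ℕ.zero}    zero    = []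
after {ℕ.suc (ℕ.suc n)} zero    = [ suc zero ]
after                   (suc i) = map suc (after i)

before-sound : ∀ {n} {i j : Fin n} → j ∈ before i → toℕ i ≡ ℕ.suc (toℕ j)
before-sound {i = suc i} (here refl) = cong ℕ.suc (sym (toℕ-inject₁ i))

before-complete : ∀ {n} {i j : Fin n} → toℕ i ≡ ℕ.suc (toℕ j) → j ∈ before i
before-complete {i = suc i} e =
  here (toℕ-injective (trans (sym (ℕ.suc-injective e)) (sym (toℕ-inject₁ i))))

after-sound : ∀ {n} {i j : Fin n} → j ∈ after i → toℕ j ≡ ℕ.suc (toℕ i)
after-sound {ℕ.suc (ℕ.suc n)} {zero}  (here refl) = refl
after-sound {i = suc i} j∈ with ∈-map⁻ suc j∈
... | _ , k∈ , refl = cong ℕ.suc (after-sound k∈)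

after-complete : ∀ {n} {i j : Fin n} → toℕ j ≡ ℕ.suc (toℕ i) → j ∈ after i
after-complete {ℕ.suc (ℕ.suc n)} {zero}  {suc zero} e = here refl
after-complete {i = suc i} {suc j} e = ∈-map⁺ suc (after-complete (ℕ.suc-injective e))

before-unique : ∀ {n} (i : Fin n) → Unique (before i)
before-unique zero    = []
before-unique (suc i) = [] ∷ []

after-unique : ∀ {n} (i : Fin n) → Unique (after i)
after-unique {ℕ.suc ℕ.zero}    zero    = []
after-unique {ℕ.suc (ℕ.suc n)} zero    = [] ∷ []
after-unique                   (suc i) = Unique.map⁺ (λ { refl → refl }) (after-unique i)

window : ∀ {n} → Fin n → List (Fin n)
window i = before i ++ i ∷ after i

-- The indices before `i`, `i` itself and those after it are strictly increasing under `toℕ`, so no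
-- index can repeat.
window-unique : ∀ {n} (i : Fin n) → Unique (window i)
window-unique i = Unique.++⁺ (before-unique i)
  (All.tabulate (λ j∈ i≡j → ℕ.<⇒≢ (i<after j∈) (cong toℕ i≡j)) ∷ after-unique i)
  λ { (j∈ , here refl)  → ℕ.<-irrefl refl (before<i j∈)
    ; (j∈ , there j∈′) → ℕ.<-asym (before<i j∈) (i<after j∈′) }
  where
  i<after : ∀ {j} → j ∈ after i → toℕ i ℕ.< toℕ j
  i<after j∈ = ℕ.≤-reflexive (sym (after-sound j∈))
  before<i : ∀ {j} → j ∈ before i → toℕ j ℕ.< toℕ i
  before<i j∈ = ℕ.≤-reflexive (sym (before-sound j∈))

-- The recurrence for the values on the spine.

head : ∀ {n} → (Fin n → Value) → Value
-- The default is the boundary value past the end of the spine; `right` inherits it at the last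
-- vertex.
head {ℕ.zero}  x = 0#
head {ℕ.suc n} x = x zero

-- The recursion hands `x zero` on as the new preceding value. Hence the conditions for the tail of
-- a spine are definitionally `bal ∘ suc`, which the inductions below use.
left : ∀ {n} → Value → (Fin n → Value) → Fin n → Value
left p x zero    = p
left p x (suc i) = left (x zero) (x ∘ suc) i

right : ∀ {n} → (Fin n → Value) → Fin n → Value
right x zero    = head (x ∘ suc)
right x (suc i) = right (x ∘ suc) i

left-suc : ∀ {n} p (x : Fin (ℕ.suc n) → Value) i → left p x (suc i) ≡ x (inject₁ i)
left-suc p x zero    = refl
left-suc p x (suc i) = left-suc (x zero) (x ∘ suc) i

sum-before : ∀ {n} (x : Fin n → Value) i →
  sumℤ (map (toℤ ∘ x) (before i)) ≡ toℤ (left 0# x i)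
sum-before x zero    = refl
sum-before x (suc i) = trans (+-identityʳ _) (cong toℤ (sym (left-suc 0# x i)))

sum-after : ∀ {n} (x : Fin n → Value) i →
  sumℤ (map (toℤ ∘ x) (after i)) ≡ toℤ (right x i)
sum-after {ℕ.suc ℕ.zero}    x zero    = refl
sum-after {ℕ.suc (ℕ.suc n)} x zero    = +-identityʳ _
sum-after                   x (suc i) =
  trans (cong sumℤ (sym (map-∘ (after i)))) (sum-after (x ∘ suc) i)

-- The balance conditions along a spine whose first vertex has a preceding
-- neighbour of value p.
Balanced : ∀ {n} → Value → (Fin n → Value) → (Fin n → ℕ) → Set
Balanced p x l = ∀ i → (+ l i - 1ℤ) * toℤ (x i) ≡ toℤ (left p x i) + toℤ (right x i)

Modified : ∀ {n} → (Fin n → Value) → (Fin n → ℕ) → Set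
Modified x l = ∀ i → l i ≢ 1 → x i ≡ -1# ⊎ x i ≡ 1#

-- The closed neighbourhood of a spine vertex.

module _ {n} {l : Fin n → ℕ} where

  spine-neighbourhood : Fin n → List (Vertex l)
  spine-neighbourhood i = map spine (window i) ++ leavesAt l i

  spine-neighbourhood-unique : ∀ i → Unique (spine-neighbourhood i)
  spine-neighbourhood-unique i = Unique.++⁺
    (Unique.map⁺ spine-injective (window-unique i))
    (Unique.map⁺ leaf-injective (Unique.allFin⁺ (l i)))
    disjoint
    where
    disjoint : ∀ {u} → ¬ (u ∈ map spine (window i) × u ∈ leavesAt l i)
    disjoint (p , q) with ∈-map⁻ spine p | ∈-map⁻ (leaf i) q
    ... | _ , _ , refl | _ , _ , ()

  spine-neighbourhood-sound : ∀ i {u} → u ∈ spine-neighbourhood i →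
    Adjacent u (spine i) ⊎ u ≡ spine i
  spine-neighbourhood-sound i u∈ with ∈-++⁻ (map spine (window i)) u∈
  ... | inj₂ q with ∈-map⁻ (leaf i) q
  ...   | _ , _ , refl = inj₁ toStem
  spine-neighbourhood-sound i u∈ | inj₁ p with ∈-map⁻ spine p
  ... | _ , j∈ , refl with ∈-++⁻ (before i) j∈
  ...   | inj₁ j∈before         = inj₁ (next (before-sound j∈before))
  ...   | inj₂ (here refl)      = inj₂ refl
  ...   | inj₂ (there j∈after)  = inj₁ (prev (after-sound j∈after))

  spine-neighbourhood-complete : ∀ i {u} → Adjacent u (spine i) ⊎ u ≡ spine i →
    u ∈ spine-neighbourhood i
  spine-neighbourhood-complete i (inj₁ (next e)) =
    ∈-++⁺ˡ (∈-map⁺ spine (∈-++⁺ˡ (before-complete e)))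
  spine-neighbourhood-complete i (inj₁ (prev e)) =
    ∈-++⁺ˡ (∈-map⁺ spine (∈-++⁺ʳ (before i) (there (after-complete e))))
  spine-neighbourhood-complete i (inj₁ toStem) =
    ∈-++⁺ʳ (map spine (window i)) (∈-map⁺ (leaf i) (∈-allFin _))
  spine-neighbourhood-complete i (inj₂ refl) =
    ∈-++⁺ˡ (∈-map⁺ spine (∈-++⁺ʳ (before i) (here refl)))

-- From balanced domination to the recurrence.

module _ {n} {l : Fin n → ℕ} (f : Vertex l → Value) (bdf : IsBDF (caterpillar l) f) where

  private
    x : Fin n → Value
    x = f ∘ spine

    g : Vertex l → ℤ
    g = toℤ ∘ f

  -- The closed neighbourhood of a leaf consists of the leaf and its stem only, so their two values
  -- cancel.
  leaf-value : ∀ i j → g (leaf i j) ≡ - toℤ (x i)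
  leaf-value i j = solved (trans (sym eq) (bdf (leaf i j)))
    where
    eq : _ ≡ toℤ (x i) + (g (leaf i j) + 0ℤ)
    eq = sumℤ-neighbourhood (caterpillar l) g (leaf i j) (spine i ∷ leaf i j ∷ [])
      (((λ ()) ∷ []) ∷ [] ∷ [])
      (λ { (here refl) → inj₁ toLeaf ; (there (here refl)) → inj₂ refl })
      (λ { (inj₁ toLeaf) → here refl ; (inj₂ refl) → there (here refl) })
    solved : ∀ {a b} → a + (b + 0ℤ) ≡ 0ℤ → b ≡ - a
    solved {a} {b} e = trans (lemma a b) (trans (cong (_- a) e) (+-identityˡ _))
      where
      lemma : ∀ a b → b ≡ a + (b + 0ℤ) - a
      lemma = solve-∀

  sum-window : ∀ i → sumℤ (map g (map spine (window i))) ≡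
    toℤ (left 0# x i) + (toℤ (x i) + toℤ (right x i))
  sum-window i = begin
    sumℤ (map g (map spine (window i)))
      ≡⟨ cong sumℤ (sym (map-∘ (window i))) ⟩
    sumℤ (map (toℤ ∘ x) (window i))
      ≡⟨ cong sumℤ (map-++ (toℤ ∘ x) (before i) _) ⟩
    sumℤ (map (toℤ ∘ x) (before i) ++ map (toℤ ∘ x) (i ∷ after i))
      ≡⟨ sumℤ-++ (map (toℤ ∘ x) (before i)) _ ⟩
    sumℤ (map (toℤ ∘ x) (before i)) + (toℤ (x i) + sumℤ (map (toℤ ∘ x) (after i)))
      ≡⟨ cong₂ _+_ (sum-before x i) (cong (_+_ (toℤ (x i))) (sum-after x i)) ⟩
    toℤ (left 0# x i) + (toℤ (x i) + toℤ (right x i)) ∎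

  sum-leavesAt : ∀ i → sumℤ (map g (leavesAt l i)) ≡ + l i * - toℤ (x i)
  sum-leavesAt i = begin
    sumℤ (map g (leavesAt l i))
      ≡⟨ cong sumℤ (sym (map-∘ (allFin (l i)))) ⟩
    sumℤ (map (g ∘ leaf i) (allFin (l i)))
      ≡⟨ cong sumℤ (map-cong (leaf-value i) (allFin (l i))) ⟩
    sumℤ (map (const (- toℤ (x i))) (allFin (l i)))
      ≡⟨ sumℤ-const (- toℤ (x i)) (allFin (l i)) ⟩
    + length (allFin (l i)) * - toℤ (x i)
      ≡⟨ cong (λ k → + k * - toℤ (x i)) (length-tabulate {n = l i} (λ j → j)) ⟩
    + l i * - toℤ (x i) ∎

  -- The closed neighbourhood splits into a stretch of spine and the leaves. The leaves contribute
  -- `+ l i * - toℤ (x i)`, which absorbs the value of the vertex itself.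
  spine-balanced : Balanced 0# x l
  spine-balanced i = solved {+ l i} {toℤ (x i)} {toℤ (left 0# x i)} (begin
    (toℤ (left 0# x i) + (toℤ (x i) + toℤ (right x i))) + + l i * - toℤ (x i)
      ≡⟨ cong₂ _+_ (sym (sum-window i)) (sym (sum-leavesAt i)) ⟩
    sumℤ (map g (map spine (window i))) + sumℤ (map g (leavesAt l i))
      ≡⟨ sym (sumℤ-++ (map g (map spine (window i))) _) ⟩
    sumℤ (map g (map spine (window i)) ++ map g (leavesAt l i))
      ≡⟨ cong sumℤ (sym (map-++ g (map spine (window i)) _)) ⟩
    sumℤ (map g (spine-neighbourhood i))
      ≡⟨ sym (sumℤ-neighbourhood (caterpillar l) g (spine i) (spine-neighbourhood i)
           (spine-neighbourhood-unique i)
           (spine-neighbourhood-sound i) (spine-neighbourhood-complete i)) ⟩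
    sumℤ (map g (FiniteSimpleGraph.N[_] (caterpillar l) (spine i)))
      ≡⟨ bdf (spine i) ⟩
    0ℤ ∎)
    where
    solved : ∀ {m y a b} → (a + (y + b)) + m * - y ≡ 0ℤ → (m - 1ℤ) * y ≡ a + b
    solved {m} {y} {a} {b} e =
      trans (lemma m y a b) (trans (cong (λ s → a + b - s) e) (+-identityʳ _))
      where
      lemma : ∀ m y a b → (m - 1ℤ) * y ≡ a + b - ((a + (y + b)) + m * - y)
      lemma = solve-∀

  -- Leaf values are negated stem values, so a non-zero function must already be non-zero somewhere
  -- on the spine.
  spine-zero⇒zero : (∀ i → x i ≡ 0#) → ∀ v → f v ≡ 0#
  spine-zero⇒zero z (spine i)  = z i
  spine-zero⇒zero z (leaf i j) =
    toℤ-zero (trans (leaf-value i j) (cong (-_ ∘ toℤ) (z i)))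

-- Zeros on the spine and the leaf count modulo 4.

zero-start⇒zero : ∀ {n} (x : Fin n → Value) (l : Fin n → ℕ) →
  Balanced 0# x l → head x ≡ 0# → ∀ i → x i ≡ 0#
zero-start⇒zero x l bal h zero    = h
zero-start⇒zero x l bal h (suc i) =
  zero-start⇒zero (x ∘ suc) (l ∘ suc)
    -- The tail sees `x zero` as its preceding value; `h` turns it into `0#`. The balance at the
    -- first vertex then makes the next value zero as well.
    (subst (λ p → Balanced p (x ∘ suc) (l ∘ suc)) h (bal ∘ suc))
    (toℤ-zero (next-zero (bal zero))) i
  where
  lemma : ∀ d → d * 0ℤ ≡ 0ℤ
  lemma = solve-∀
  next-zero : (+ l zero - 1ℤ) * toℤ (x zero) ≡ 0ℤ + toℤ (head (x ∘ suc)) →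
              toℤ (head (x ∘ suc)) ≡ 0ℤ
  next-zero e rewrite h = trans (sym (+-identityˡ _)) (trans (sym e) (lemma (+ l zero - 1ℤ)))

-- If `m` is 1, then `s` is 0. Otherwise `toℤ y` is its own inverse, and multiplying the balance
-- equation by it isolates `m`. One formula thus serves both cases.
leaf-count : ∀ (m : ℕ) y s → (+ m - 1ℤ) * toℤ y ≡ s →
  (m ≢ 1 → y ≡ -1# ⊎ y ≡ 1#) → + m ≡ 1ℤ + toℤ y * s
leaf-count m y s refl ok with m ℕ.≟ 1
... | yes refl = lemma (toℤ y)
  where
  lemma : ∀ y → 1ℤ ≡ 1ℤ + y * ((1ℤ - 1ℤ) * y)
  lemma = solve-∀
... | no m≢1 with ok m≢1
...   | inj₁ refl = lemma (+ m)
  where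
  lemma : ∀ m → m ≡ 1ℤ + -1ℤ * ((m - 1ℤ) * -1ℤ)
  lemma = solve-∀
...   | inj₂ refl = lemma (+ m)
  where
  lemma : ∀ m → m ≡ 1ℤ + 1ℤ * ((m - 1ℤ) * 1ℤ)
  lemma = solve-∀

-- A check of all pairs of values. Two zeros would give -2, which is why that pair is excluded.
quadratic-mod4 : ∀ y z → ¬ (y ≡ 0# × z ≡ 0#) →
  ∃ λ k → (+ 2 * (toℤ y * toℤ y) + + 2 * (toℤ y * toℤ z)) - (+ 2 * (toℤ z * toℤ z) + + 2) ≡ k * + 4
quadratic-mod4 -1# -1# _ = 0ℤ , refl
quadratic-mod4 -1# 0#  _ = 0ℤ , refl
quadratic-mod4 -1# 1#  _ = -1ℤ , refl
quadratic-mod4 0#  -1# _ = -1ℤ , refl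
quadratic-mod4 0#  0#  h = contradiction (refl , refl) h
quadratic-mod4 0#  1#  _ = -1ℤ , refl
quadratic-mod4 1#  -1# _ = -1ℤ , refl
quadratic-mod4 1#  0#  _ = 0ℤ , refl
quadratic-mod4 1#  1#  _ = 0ℤ , refl

-- Induction on the spine length. The preceding value `p` is arbitrary because removing the first
-- vertex turns its value into the preceding value of the rest.
leaves-mod4 : ∀ {n} p (x : Fin n → Value) (l : Fin n → ℕ) → Balanced p x l → Modified x l →
  ¬ (p ≡ 0# × head x ≡ 0#) →
  ∃ λ k → + totalLeaves l ≡
    (+ 3 * + n + toℤ p * toℤ (head x)) - + 2 * (toℤ (head x) * toℤ (head x)) + k * + 4
leaves-mod4 {ℕ.zero} p x l bal mod nz = 0ℤ , lemma (toℤ p)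
  where
  lemma : ∀ p → 0ℤ ≡ (+ 3 * 0ℤ + p * 0ℤ) - + 2 * (0ℤ * 0ℤ) + 0ℤ * + 4
  lemma = solve-∀
leaves-mod4 {ℕ.suc n} p x l bal mod nz
  with leaves-mod4 (x zero) (x ∘ suc) (l ∘ suc) (bal ∘ suc) (mod ∘ suc) nz′
     | quadratic-mod4 (x zero) (head (x ∘ suc)) nz′
  where
  lemma : ∀ d → d * 0ℤ ≡ 0ℤ
  lemma = solve-∀
  -- Zeros also propagate backwards: if the first two values vanish, the balance at the first vertex
  -- forces `p` to vanish, against `nz`.
  nz′ : ¬ (x zero ≡ 0# × head (x ∘ suc) ≡ 0#)
  nz′ (y≡0 , z≡0) = nz (toℤ-zero p≡0 , y≡0)
    where
    p≡0 : toℤ p ≡ 0ℤ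
    p≡0 = begin
      toℤ p                                ≡⟨ sym (+-identityʳ _) ⟩
      toℤ p + 0ℤ                           ≡⟨ cong (λ z → toℤ p + toℤ z) (sym z≡0) ⟩
      toℤ p + toℤ (head (x ∘ suc))         ≡⟨ sym (bal zero) ⟩
      (+ l zero - 1ℤ) * toℤ (x zero)       ≡⟨ cong (λ y → (+ l zero - 1ℤ) * toℤ y) y≡0 ⟩
      (+ l zero - 1ℤ) * 0ℤ                 ≡⟨ lemma (+ l zero - 1ℤ) ⟩
      0ℤ                                   ∎
... | k , rest | q , quad = k + q , (begin
  + l zero + + totalLeaves (l ∘ suc)
    ≡⟨ cong₂ _+_ (leaf-count (l zero) (x zero) _ (bal zero) (mod zero)) rest ⟩
  (1ℤ + y * (P + z)) + ((+ 3 * + n + y * z) - + 2 * (z * z) + k * + 4)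
    -- The first vertex's leaves plus the formula for the tail exceed the formula for the whole by
    -- exactly the quadratic expression of `quadratic-mod4`.
    ≡⟨ split (+ n) P y z (k * + 4) ⟩
  ((+ 3 * (1ℤ + + n) + P * y) - + 2 * (y * y) + k * + 4)
    + ((+ 2 * (y * y) + + 2 * (y * z)) - (+ 2 * (z * z) + + 2))
    ≡⟨ cong (_+_ ((+ 3 * (1ℤ + + n) + P * y) - + 2 * (y * y) + k * + 4)) quad ⟩
  ((+ 3 * (1ℤ + + n) + P * y) - + 2 * (y * y) + k * + 4) + q * + 4
    ≡⟨ collect ((+ 3 * (1ℤ + + n) + P * y) - + 2 * (y * y)) k q ⟩
  (+ 3 * (1ℤ + + n) + P * y) - + 2 * (y * y) + (k + q) * + 4 ∎)
  where
  P y z : ℤ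
  P = toℤ p
  y = toℤ (x zero)
  z = toℤ (head (x ∘ suc))
  split : ∀ n p y z r →
    (1ℤ + y * (p + z)) + ((+ 3 * n + y * z) - + 2 * (z * z) + r) ≡
    ((+ 3 * (1ℤ + n) + p * y) - + 2 * (y * y) + r)
      + ((+ 2 * (y * y) + + 2 * (y * z)) - (+ 2 * (z * z) + + 2))
  split = solve-∀
  collect : ∀ a k q → (a + k * + 4) + q * + 4 ≡ a + (k + q) * + 4
  collect = solve-∀

toℤ-square : ∀ y → y ≢ 0# → toℤ y * toℤ y ≡ 1ℤ
toℤ-square -1# _   = refl
toℤ-square 0#  y≢0 = contradiction refl y≢0
toℤ-square 1#  _   = refl

theorem6 : (n : ℕ) → n ≥ 2 → (l : Fin n → ℕ) →
    (∃ λ (f : Vertex l → Value) → IsMBDF l f × NonZeroFunction f) →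
    + totalLeaves l ≡ + 3 * + n - + 2 [mod + 4 ]
theorem6 n _ l (f , (bdf , mod) , f≢0) = ∣⇒∣ᵤ (divides k (begin
  + totalLeaves l - T
    ≡⟨ cong (_- T) (proj₂ count) ⟩
  ((+ 3 * + n + 0ℤ * y) - + 2 * (y * y) + k * + 4) - T
    -- The first spine value is non-zero, so its square is 1; this produces the constant -2 of the
    -- congruence. The product with the preceding value vanishes, as that value is 0.
    ≡⟨ cong (λ s → ((+ 3 * + n + 0ℤ * y) - + 2 * s + k * + 4) - T) (toℤ-square _ head≢0) ⟩
  ((+ 3 * + n + 0ℤ * y) - + 2 * 1ℤ + k * + 4) - T
    ≡⟨ lemma (+ n) y (k * + 4) ⟩
  k * + 4 ∎))
  where
  x : Fin n → Value
  x = f ∘ spine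
  balanced : Balanced 0# x l
  balanced = spine-balanced f bdf
  head≢0 : head x ≢ 0#
  -- If the first value were zero, the zero boundary before it would make the whole spine zero, and
  -- with it every leaf.
  head≢0 h = f≢0 (spine-zero⇒zero f bdf (zero-start⇒zero x l balanced h))
  count = leaves-mod4 0# x l balanced mod (head≢0 ∘ proj₂)
  k T y : ℤ
  k = proj₁ count
  T = + 3 * + n - + 2
  y = toℤ (head x)
  lemma : ∀ n y r → ((+ 3 * n + 0ℤ * y) - + 2 * 1ℤ + r) - (+ 3 * n - + 2) ≡ r
  lemma = solve-∀
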